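{- Over $\mathbb{F}_5$, in $\mathbb{F}_5^5$, there exist multispreads with parameters $(80,7)_5^{3,5}$, $(56,8)_5^{3,5}$ and $(32,9)_5^{3,5}$. More precisely, there exist multisets of subspaces of $\mathbb{F}_5^5$ consisting of, respectively, (a) $20$ two-dimensional and $157$ three-dimensional subspaces, (b) $14$ two-dimensional and $188$ three-dimensional subspaces, (c) $8$ two-dimensional and $219$ three-dimensional subspaces, such that in each case every hyperplane of $\mathbb{F}_5^5$ contains exactly $2$ of the subspaces (counted with multiplicity); these are multispreads with the parameters $(80,7)_5^{3,5}$, $(56,8)_5^{3,5}$, $(32,9)_5^{3,5}$, respectively.
   Context: All dimensions are vector-space dimensions; a hyperplane of $\mathbb{F}_q^k$ is a $(k-1)$-dimensional subspace. A $(\lambda,\mu)_q^{h,k}$-multispread is a collection (multiset) $\mathcal{S}$ of subspaces of $\mathbb{F}_q^k$ of dimension at most $h$ such that $\sum_{S\in\mathcal{S},\,v\in S}q^{h-\dim S}=\mu$ for every non-zero vector $v\in\mathbb{F}_q^k$, and $\sum_{S\in\mathcal{S}}(q^{h-\dim S}-1)=\lambda$. -}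

module Defs where

open import Algebra.Structures using (IsCommutativeRing)
open import Data.Fin.Base using (Fin; toℕ)
open import Data.Fin.Properties using (_≟_; all?; any?)
open import Data.List.Base using (List; map; filter; length; sum)
open import Data.List.Relation.Unary.All using (All)
open import Data.Nat.Base as ℕ using (ℕ; suc; _∸_; _^_; _≤_)
open import Data.Nat.DivMod using (_mod_)
open import Data.Product.Base using (∃-syntax; _,_)
open import Data.Vec.Base as Vec using (Vec; []; _∷_; replicate; zipWith)
open import Data.Vec.Relation.Unary.All as VecAll using ([]; _∷_)
open import Level using (0ℓ)
open import Relation.Binary.PropositionalEquality
  using (_≡_; _≢_; refl; isEquivalence; cong₂)
open import Relation.Nullary.Decidable using (Dec; from-yes; map′; ¬?; _→-dec_)
open import Relation.Unary using (Pred; Decidable)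

-- A field with q elements, carried by Fin q up to a choice of enumeration
-- (the element zero of Fin q need not be 0#).
record FiniteField (q : ℕ) : Set where
  infixl 6 _+_
  infixl 7 _*_
  infix  8 -_
  field
    _+_ _*_ : Fin q → Fin q → Fin q
    -_      : Fin q → Fin q
    0# 1#   : Fin q
    isCommutativeRing : IsCommutativeRing _≡_ _+_ _*_ -_ 0# 1#
    0≢1     : 0# ≢ 1#
    inverse : ∀ x → x ≢ 0# → ∃[ y ] x * y ≡ 1#


module LinearAlgebra {q : ℕ} (F : FiniteField q) where
  open FiniteField F

  V : ℕ → Set
  V k = Vec (Fin q) k

  0ᵛ : ∀ {k} → V k
  0ᵛ {k} = replicate k 0#

  infixl 6 _+ᵛ_
  infixr 7 _·ᵛ_

  _+ᵛ_ : ∀ {k} → V k → V k → V k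
  _+ᵛ_ = zipWith _+_

  _·ᵛ_ : ∀ {k} → Fin q → V k → V k
  c ·ᵛ v = Vec.map (c *_) v

  linComb : ∀ {k d} → Vec (Fin q) d → Vec (V k) d → V k
  linComb []       []       = 0ᵛ
  linComb (c ∷ cs) (b ∷ bs) = c ·ᵛ b +ᵛ linComb cs bs

  -- The basis is carried along as the witness of the dimension; membership is
  -- decidable, as for every subset of a finite set classically, so that the
  -- members of a multiset containing a given vector can be counted.
  record Subspace (k : ℕ) : Set₁ where
    field
      Mem      : Pred (V k) 0ℓ
      mem?     : Decidable Mem
      0-closed : Mem 0ᵛ
      +-closed : ∀ {u v} → Mem u → Mem v → Mem (u +ᵛ v)
      ·-closed : ∀ c {v} → Mem v → Mem (c ·ᵛ v)

      dim         : ℕ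
      basis       : Vec (V k) dim
      basis⊆      : VecAll.All Mem basis
      independent : ∀ cs → linComb cs basis ≡ 0ᵛ → cs ≡ replicate dim 0#
      spanning    : ∀ {v} → Mem v → ∃[ cs ] v ≡ linComb cs basis

  open Subspace public using (dim)

  infix 4 _∈_ _∈?_ _⊆_ _⊆?_

  _∈_ : ∀ {k} → V k → Subspace k → Set
  v ∈ S = Subspace.Mem S v

  _∈?_ : ∀ {k} (v : V k) (S : Subspace k) → Dec (v ∈ S)
  v ∈? S = Subspace.mem? S v

  _⊆_ : ∀ {k} → Subspace k → Subspace k → Set
  S ⊆ T = ∀ {v} → v ∈ S → v ∈ T

  linComb-closed : ∀ {k d} (T : Subspace k) (cs : Vec (Fin q) d) {bs : Vec (V k) d} →
                   VecAll.All (_∈ T) bs → linComb cs bs ∈ T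
  linComb-closed T []       []       = Subspace.0-closed T
  linComb-closed T (c ∷ cs) (p ∷ ps) =
    Subspace.+-closed T (Subspace.·-closed T c p) (linComb-closed T cs ps)

  _⊆?_ : ∀ {k} (S T : Subspace k) → Dec (S ⊆ T)
  S ⊆? T = map′ to from (VecAll.all? (_∈? T) (Subspace.basis S))
    where
    to : VecAll.All (_∈ T) (Subspace.basis S) → S ⊆ T
    to ps v∈S with Subspace.spanning S v∈S
    ... | cs , refl = linComb-closed T cs ps

    from : S ⊆ T → VecAll.All (_∈ T) (Subspace.basis S)
    from S⊆T = VecAll.map (λ b∈S → S⊆T b∈S) (Subspace.basis⊆ S)

  IsHyperplane : ∀ {k} → Subspace k → Set
  IsHyperplane {k} H = suc (dim H) ≡ k

  -- Multisets of subspaces are lists: the notions below do not depend on the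
  -- order of the entries, and repeated entries are counted with multiplicity.

  #ContainedIn : ∀ {k} → List (Subspace k) → Subspace k → ℕ
  #ContainedIn 𝒮 H = length (filter (_⊆? H) 𝒮)

  record IsMultispread (lam μ h k : ℕ) (𝒮 : List (Subspace k)) : Set₁ where
    field
      dim≤h  : All (λ S → dim S ≤ h) 𝒮
      cover  : ∀ (v : V k) → v ≢ 0ᵛ →
               sum (map (λ S → q ^ (h ∸ dim S)) (filter (v ∈?_) 𝒮)) ≡ μ
      excess : sum (map (λ S → q ^ (h ∸ dim S) ∸ 1) 𝒮) ≡ lam

𝔽₅ : FiniteField 5
𝔽₅ = record
  { _+_ = _+_ ; _*_ = _*_ ; -_ = -_ ; 0# = 0# ; 1# = 1#
  ; isCommutativeRing = record
    { isRing = record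
      { +-isAbelianGroup = record
        { isGroup = record
          { isMonoid = record
            { isSemigroup = record
              { isMagma = record { isEquivalence = isEquivalence ; ∙-cong = cong₂ _+_ }
              ; assoc = from-yes (all? λ x → all? λ y → all? λ z → (x + y) + z ≟ x + (y + z))
              }
            ; identity = from-yes (all? λ x → 0# + x ≟ x)
                       , from-yes (all? λ x → x + 0# ≟ x)
            }
          ; inverse = from-yes (all? λ x → (- x) + x ≟ 0#)
                    , from-yes (all? λ x → x + (- x) ≟ 0#)
          ; ⁻¹-cong = λ { refl → refl }
          }
        ; comm = from-yes (all? λ x → all? λ y → x + y ≟ y + x)
        }
      ; *-cong = cong₂ _*_
      ; *-assoc = from-yes (all? λ x → all? λ y → all? λ z → (x * y) * z ≟ x * (y * z))
      ; *-identity = from-yes (all? λ x → 1# * x ≟ x)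
                   , from-yes (all? λ x → x * 1# ≟ x)
      ; distrib = from-yes (all? λ x → all? λ y → all? λ z → x * (y + z) ≟ x * y + x * z)
                , from-yes (all? λ x → all? λ y → all? λ z → (y + z) * x ≟ y * x + z * x)
      }
    ; *-comm = from-yes (all? λ x → all? λ y → x * y ≟ y * x)
    }
  ; 0≢1 = λ ()
  ; inverse = from-yes (all? λ x → ¬? (x ≟ 0#) →-dec any? λ y → x * y ≟ 1#)
  }
  where
  infixl 6 _+_
  infixl 7 _*_
  _+_ _*_ : Fin 5 → Fin 5 → Fin 5
  x + y = (toℕ x ℕ.+ toℕ y) mod 5
  x * y = (toℕ x ℕ.* toℕ y) mod 5

  -_ : Fin 5 → Fin 5
  - x = (5 ∸ toℕ x) mod 5

  0# 1# : Fin 5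
  0# = 0 mod 5
  1# = 1 mod 5

module Submission where

-- Passing to annihilators, a subspace S lies in the hyperplane n^⊥ exactly when n lies in
-- S^⊥, so each multiset is dual to a family of lines and planes of PG(4,5) covering every
-- point exactly twice.  Families (a) and (c) are unions of orbits of a group of order 12 and
-- come from an exact cover search on its orbits.  Family (b) comes from a second family of
-- type (a), invariant under a group of order 6: it contains the six planes x ⊗ 𝔽₅³ of a Segre
-- variety of 𝔽₅² ⊗ 𝔽₅³ projected to 𝔽₅⁵, and these can be traded for the 31 lines 𝔽₅² ⊗ y.
-- Every hyperplane has a normal vector by pigeonhole, so both counting conditions reduce to
-- the 781 normalised vectors, where they are decided by evaluation.

open import Defs
open import Algebra.Bundles using (CommutativeRing)
open import Data.Bool.Base using (true)
open import Data.Fin.Base as Fin using (Fin; combine; remQuot; toℕ)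
open import Data.Fin.Properties as Fin
  using (_≟_; combine-remQuot; combine-injective; pigeonhole; toℕ-injective; toℕ-fromℕ<)
open import Data.List.Base as List using (List; []; _∷_; map; replicate; _++_)
open import Data.List.Properties using (filter-≐)
open import Data.List.Relation.Binary.Permutation.Propositional using (_↭_; ↭-reflexive)
open import Data.List.Relation.Unary.All as All using (All; []; _∷_)
import Data.List.Relation.Unary.All.Properties as All
open import Data.Nat as ℕ using (ℕ; zero; suc; _∸_; _^_; _/_)
open import Data.Nat.DivMod using (_mod_; _%_; %-distribˡ-+)
open import Data.Nat.ListAction using (sum)
import Data.Nat.Properties as ℕ
open import Data.Product.Base using (Σ-syntax; ∃-syntax; _×_; _,_; proj₁; proj₂)
open import Data.Vec.Base as Vec using (Vec; []; _∷_; _∷ʳ_; zipWith)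
open import Data.Vec.Properties using (∷-injective)
open import Data.Vec.Relation.Unary.All as VecAll using ([]; _∷_)
open import Function.Base using (_∘_)
open import Function.Bundles using (_⇔_; mk⇔; module Equivalence)
open import Relation.Binary.PropositionalEquality
open import Relation.Nullary.Decidable using (Dec; yes; no; map′; _×-dec_; does)
open import Relation.Nullary.Negation using (contradiction)
open import Relation.Unary using (Decidable)

module FiniteLinearAlgebra {q : ℕ} (F : FiniteField q) where
  open FiniteField F
  open LinearAlgebra F

  commutativeRing : CommutativeRing _ _
  commutativeRing = record { isCommutativeRing = isCommutativeRing }

  open CommutativeRing commutativeRing
    using ( +-assoc; +-comm; +-identityˡ; +-identityʳ; -‿inverseˡ; -‿inverseʳ
          ; *-assoc; *-comm; *-identityˡ; *-identityʳ; distribˡ; distribʳ; zeroˡ; zeroʳ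
          ; ring; +-commutativeSemigroup; *-commutativeSemigroup )
  open import Algebra.Properties.CommutativeSemigroup +-commutativeSemigroup
    using () renaming (interchange to +-interchange)
  open import Algebra.Properties.CommutativeSemigroup *-commutativeSemigroup
    using () renaming (x∙yz≈y∙xz to x*yz≡y*xz)
  open import Algebra.Properties.Ring ring
    using (-‿distribˡ-*; -‿involutive; -1*x≈-x; x∙y⁻¹≈ε⇒x≈y)
  open ≡-Reasoning

  private variable
    k d : ℕ

  -- Vector arithmetic over an arbitrary finite field.

  +ᵛ-identityˡ : (v : V k) → 0ᵛ +ᵛ v ≡ v
  +ᵛ-identityˡ []      = refl
  +ᵛ-identityˡ (x ∷ v) = cong₂ _∷_ (+-identityˡ x) (+ᵛ-identityˡ v)

  +ᵛ-identityʳ : (v : V k) → v +ᵛ 0ᵛ ≡ v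
  +ᵛ-identityʳ []      = refl
  +ᵛ-identityʳ (x ∷ v) = cong₂ _∷_ (+-identityʳ x) (+ᵛ-identityʳ v)

  +ᵛ-interchange : (a b c e : V k) → (a +ᵛ b) +ᵛ (c +ᵛ e) ≡ (a +ᵛ c) +ᵛ (b +ᵛ e)
  +ᵛ-interchange []      []      []      []      = refl
  +ᵛ-interchange (a ∷ u) (b ∷ v) (c ∷ w) (e ∷ x) =
    cong₂ _∷_ (+-interchange a b c e) (+ᵛ-interchange u v w x)

  ·ᵛ-zeroˡ : (v : V k) → 0# ·ᵛ v ≡ 0ᵛ
  ·ᵛ-zeroˡ []      = refl
  ·ᵛ-zeroˡ (x ∷ v) = cong₂ _∷_ (zeroˡ x) (·ᵛ-zeroˡ v)

  ·ᵛ-zeroʳ : ∀ c → c ·ᵛ 0ᵛ {k} ≡ 0ᵛ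
  ·ᵛ-zeroʳ {zero}  c = refl
  ·ᵛ-zeroʳ {suc k} c = cong₂ _∷_ (zeroʳ c) (·ᵛ-zeroʳ c)

  ·ᵛ-identity : (v : V k) → 1# ·ᵛ v ≡ v
  ·ᵛ-identity []      = refl
  ·ᵛ-identity (x ∷ v) = cong₂ _∷_ (*-identityˡ x) (·ᵛ-identity v)

  ·ᵛ-assoc : ∀ a b (v : V k) → (a * b) ·ᵛ v ≡ a ·ᵛ b ·ᵛ v
  ·ᵛ-assoc a b []      = refl
  ·ᵛ-assoc a b (x ∷ v) = cong₂ _∷_ (*-assoc a b x) (·ᵛ-assoc a b v)

  ·ᵛ-distribˡ : ∀ c (u v : V k) → c ·ᵛ (u +ᵛ v) ≡ c ·ᵛ u +ᵛ c ·ᵛ v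
  ·ᵛ-distribˡ c []      []      = refl
  ·ᵛ-distribˡ c (x ∷ u) (y ∷ v) = cong₂ _∷_ (distribˡ c x y) (·ᵛ-distribˡ c u v)

  ·ᵛ-distribʳ : ∀ a b (v : V k) → (a + b) ·ᵛ v ≡ a ·ᵛ v +ᵛ b ·ᵛ v
  ·ᵛ-distribʳ a b []      = refl
  ·ᵛ-distribʳ a b (x ∷ v) = cong₂ _∷_ (distribʳ x a b) (·ᵛ-distribʳ a b v)

  infixl 6 _-ᵛ_
  -- Written as addition of a multiple by `- 1#`, so that linearity of `linComb` in its coefficients
  -- applies directly to differences.
  _-ᵛ_ : V k → V k → V k
  u -ᵛ v = u +ᵛ (- 1#) ·ᵛ v

  v-v≡0 : (v : V k) → v -ᵛ v ≡ 0ᵛ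
  v-v≡0 v = begin
    v +ᵛ (- 1#) ·ᵛ v          ≡⟨ cong (_+ᵛ (- 1#) ·ᵛ v) (·ᵛ-identity v) ⟨
    1# ·ᵛ v +ᵛ (- 1#) ·ᵛ v    ≡⟨ ·ᵛ-distribʳ 1# (- 1#) v ⟨
    (1# + - 1#) ·ᵛ v          ≡⟨ cong (_·ᵛ v) (-‿inverseʳ 1#) ⟩
    0# ·ᵛ v                   ≡⟨ ·ᵛ-zeroˡ v ⟩
    0ᵛ                        ∎

  u-v≡0⇒u≡v : (u v : V k) → u -ᵛ v ≡ 0ᵛ → u ≡ v
  u-v≡0⇒u≡v []      []      _  = refl
  u-v≡0⇒u≡v (x ∷ u) (y ∷ v) eq with h , t ← ∷-injective eq =
    cong₂ _∷_ x≡y (u-v≡0⇒u≡v u v t)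
    where
    x≡y : x ≡ y
    x≡y = begin
      x                      ≡⟨ +-identityʳ x ⟨
      x + 0#                 ≡⟨ cong (x +_) (-‿inverseˡ y) ⟨
      x + (- y + y)          ≡⟨ cong (λ t → x + (- t + y)) (*-identityˡ y) ⟨
      x + (- (1# * y) + y)   ≡⟨ cong (λ t → x + (t + y)) (-‿distribˡ-* 1# y) ⟩
      x + ((- 1#) * y + y)   ≡⟨ +-assoc x _ y ⟨
      (x + (- 1#) * y) + y   ≡⟨ cong (_+ y) h ⟩
      0# + y                 ≡⟨ +-identityˡ y ⟩
      y                      ∎

  -- Linear combinations

  linComb-+ : (as bs : Vec (Fin q) d) (vs : Vec (V k) d) →
              linComb (as +ᵛ bs) vs ≡ linComb as vs +ᵛ linComb bs vs
  linComb-+ []       []       []       = sym (+ᵛ-identityˡ 0ᵛ)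
  linComb-+ (a ∷ as) (b ∷ bs) (v ∷ vs) = begin
    (a + b) ·ᵛ v +ᵛ linComb (as +ᵛ bs) vs
      ≡⟨ cong₂ _+ᵛ_ (·ᵛ-distribʳ a b v) (linComb-+ as bs vs) ⟩
    (a ·ᵛ v +ᵛ b ·ᵛ v) +ᵛ (linComb as vs +ᵛ linComb bs vs)
      ≡⟨ +ᵛ-interchange _ _ _ _ ⟩
    (a ·ᵛ v +ᵛ linComb as vs) +ᵛ (b ·ᵛ v +ᵛ linComb bs vs) ∎

  linComb-· : ∀ c (as : Vec (Fin q) d) (vs : Vec (V k) d) →
              linComb (c ·ᵛ as) vs ≡ c ·ᵛ linComb as vs
  linComb-· c []       []       = sym (·ᵛ-zeroʳ c)
  linComb-· c (a ∷ as) (v ∷ vs) = begin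
    (c * a) ·ᵛ v +ᵛ linComb (c ·ᵛ as) vs    ≡⟨ cong₂ _+ᵛ_ (·ᵛ-assoc c a v) (linComb-· c as vs) ⟩
    c ·ᵛ a ·ᵛ v +ᵛ c ·ᵛ linComb as vs       ≡⟨ ·ᵛ-distribˡ c _ _ ⟨
    c ·ᵛ (a ·ᵛ v +ᵛ linComb as vs)          ∎

  linComb-0 : (vs : Vec (V k) d) → linComb 0ᵛ vs ≡ 0ᵛ
  linComb-0 []       = refl
  linComb-0 (v ∷ vs) = begin
    0# ·ᵛ v +ᵛ linComb 0ᵛ vs  ≡⟨ cong₂ _+ᵛ_ (·ᵛ-zeroˡ v) (linComb-0 vs) ⟩
    0ᵛ +ᵛ 0ᵛ                  ≡⟨ +ᵛ-identityˡ 0ᵛ ⟩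
    0ᵛ                        ∎

  -- Linear dependence

  -- Base-q numbering of the vectors, which makes the pigeonhole principle on `Fin` available for
  -- them.
  encode : V k → Fin (q ^ k)
  encode []      = Fin.zero
  encode (x ∷ v) = combine x (encode v)

  decode : Fin (q ^ k) → V k
  decode {zero}  _ = []
  decode {suc k} i = let x , j = remQuot (q ^ k) i in x ∷ decode j

  encode-injective : (u v : V k) → encode u ≡ encode v → u ≡ v
  encode-injective []      []      _  = refl
  encode-injective (x ∷ u) (y ∷ v) eq with refl , eq′ ← combine-injective x _ y _ eq =
    cong (x ∷_) (encode-injective u v eq′)

  encode-decode : (i : Fin (q ^ k)) → encode (decode {k} i) ≡ i
  encode-decode {zero}  Fin.zero = refl
  encode-decode {suc k} i = trans
    (cong (combine (proj₁ (remQuot {q} (q ^ k) i))) (encode-decode {k} (proj₂ (remQuot {q} (q ^ k) i))))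
    (combine-remQuot {q} (q ^ k) i)

  -- Two distinct field elements exist; this makes powers of q strictly increasing in the exponent.
  1<q : 1 ℕ.< q
  1<q = go q 0# 1# 0≢1
    where
    go : ∀ n (x y : Fin n) → x ≢ y → 1 ℕ.< n
    go 1             Fin.zero Fin.zero x≢y = contradiction refl x≢y
    go (suc (suc _)) _        _        _   = ℕ.s≤s (ℕ.s≤s ℕ.z≤n)

  -- There are q^d coefficient vectors but only q^k possible values, so two different coefficient
  -- vectors give the same combination. Their difference is a non-trivial relation.
  dependent : k ℕ.< d → (vs : Vec (V k) d) → ∃[ cs ] cs ≢ 0ᵛ × linComb cs vs ≡ 0ᵛ
  dependent {d = d} k<d vs
    with i , j , i<j , eq ← pigeonhole (ℕ.^-monoʳ-< q 1<q k<d)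
                                        (λ i → encode (linComb (decode {d} i) vs))
    = a -ᵛ b , nonzero , relation
    where
    a b : V d
    a = decode i
    b = decode j

    nonzero : a -ᵛ b ≢ 0ᵛ
    nonzero a-b≡0 = Fin.<⇒≢ i<j (begin
      i         ≡⟨ encode-decode {d} i ⟨
      encode a  ≡⟨ cong encode (u-v≡0⇒u≡v a b a-b≡0) ⟩
      encode b  ≡⟨ encode-decode {d} j ⟩
      j         ∎)

    relation : linComb (a -ᵛ b) vs ≡ 0ᵛ
    relation = begin
      linComb (a -ᵛ b) vs             ≡⟨ linComb-+ a _ vs ⟩
      linComb a vs +ᵛ linComb ((- 1#) ·ᵛ b) vs
        ≡⟨ cong (linComb a vs +ᵛ_) (linComb-· (- 1#) b vs) ⟩
      linComb a vs -ᵛ linComb b vs    ≡⟨ cong (_-ᵛ linComb b vs) (encode-injective _ _ eq) ⟩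
      linComb b vs -ᵛ linComb b vs    ≡⟨ v-v≡0 _ ⟩
      0ᵛ                              ∎

  -- The standard bilinear form

  dot : V k → V k → Fin q
  dot []      []      = 0#
  dot (x ∷ u) (y ∷ v) = x * y + dot u v

  dot-+ʳ : (n u v : V k) → dot n (u +ᵛ v) ≡ dot n u + dot n v
  dot-+ʳ []      []      []      = sym (+-identityˡ 0#)
  dot-+ʳ (x ∷ n) (y ∷ u) (z ∷ v) = begin
    x * (y + z) + dot n (u +ᵛ v)            ≡⟨ cong₂ _+_ (distribˡ x y z) (dot-+ʳ n u v) ⟩
    (x * y + x * z) + (dot n u + dot n v)   ≡⟨ +-interchange _ _ _ _ ⟩
    (x * y + dot n u) + (x * z + dot n v)   ∎

  dot-·ʳ : ∀ c (n v : V k) → dot n (c ·ᵛ v) ≡ c * dot n v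
  dot-·ʳ c []      []      = sym (zeroʳ c)
  dot-·ʳ c (x ∷ n) (y ∷ v) = begin
    x * (c * y) + dot n (c ·ᵛ v)  ≡⟨ cong₂ _+_ (x*yz≡y*xz x c y) (dot-·ʳ c n v) ⟩
    c * (x * y) + c * dot n v     ≡⟨ distribˡ c _ _ ⟨
    c * (x * y + dot n v)         ∎

  dot-·ˡ : ∀ c (n v : V k) → dot (c ·ᵛ n) v ≡ c * dot n v
  dot-·ˡ c []      []      = sym (zeroʳ c)
  dot-·ˡ c (x ∷ n) (y ∷ v) = begin
    c * x * y + dot (c ·ᵛ n) v  ≡⟨ cong₂ _+_ (*-assoc c x y) (dot-·ˡ c n v) ⟩
    c * (x * y) + c * dot n v   ≡⟨ distribˡ c _ _ ⟨
    c * (x * y + dot n v)       ∎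

  dot-comm : (u v : V k) → dot u v ≡ dot v u
  dot-comm []      []      = refl
  dot-comm (x ∷ u) (y ∷ v) = cong₂ _+_ (*-comm x y) (dot-comm u v)

  dot-zeroˡ : (v : V k) → dot 0ᵛ v ≡ 0#
  dot-zeroˡ []      = refl
  dot-zeroˡ (x ∷ v) = trans (cong₂ _+_ (zeroˡ x) (dot-zeroˡ v)) (+-identityˡ 0#)

  dot-zeroʳ : (n : V k) → dot n 0ᵛ ≡ 0#
  dot-zeroʳ []      = refl
  dot-zeroʳ (x ∷ n) = trans (cong₂ _+_ (zeroʳ x) (dot-zeroʳ n)) (+-identityˡ 0#)

  dot-0∷ : ∀ (n : V k) x v → dot (0# ∷ n) (x ∷ v) ≡ dot n v
  dot-0∷ n x v = trans (cong (_+ dot n v) (zeroˡ x)) (+-identityˡ _)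

  dot-+-closed : ∀ (n : V k) {u v} → dot n u ≡ 0# → dot n v ≡ 0# → dot n (u +ᵛ v) ≡ 0#
  dot-+-closed n {u} {v} nu nv =
    trans (dot-+ʳ n u v) (trans (cong₂ _+_ nu nv) (+-identityˡ 0#))

  dot-·-closed : ∀ (n : V k) c {v} → dot n v ≡ 0# → dot n (c ·ᵛ v) ≡ 0#
  dot-·-closed n c {v} nv = trans (dot-·ʳ c n v) (trans (cong (c *_) nv) (zeroʳ c))

  dot-linComb : ∀ (n : V k) cs {vs : Vec (V k) d} →
                VecAll.All (λ v → dot n v ≡ 0#) vs → dot n (linComb cs vs) ≡ 0#
  dot-linComb n []       []       = dot-zeroʳ n
  dot-linComb n (c ∷ cs) (p ∷ ps) =
    dot-+-closed n (dot-·-closed n c p) (dot-linComb n cs ps)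

  linComb-∷ : ∀ (cs xs : V d) (vs : Vec (V k) d) →
              linComb cs (zipWith _∷_ xs vs) ≡ dot cs xs ∷ linComb cs vs
  linComb-∷ []       []       []       = refl
  linComb-∷ (c ∷ cs) (x ∷ xs) (v ∷ vs) =
    cong ((c * x ∷ c ·ᵛ v) +ᵛ_) (linComb-∷ cs xs vs)

  linComb-0∷ : ∀ (cs : V d) (vs : Vec (V k) d) →
               linComb cs (Vec.map (0# ∷_) vs) ≡ 0# ∷ linComb cs vs
  linComb-0∷ []       []       = refl
  linComb-0∷ (c ∷ cs) (v ∷ vs) = begin
    (c * 0# ∷ c ·ᵛ v) +ᵛ linComb cs (Vec.map (0# ∷_) vs)
      ≡⟨ cong₂ (λ x w → (x ∷ c ·ᵛ v) +ᵛ w) (zeroʳ c) (linComb-0∷ cs vs) ⟩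
    (0# + 0#) ∷ (c ·ᵛ v +ᵛ linComb cs vs)
      ≡⟨ cong (_∷ (c ·ᵛ v +ᵛ linComb cs vs)) (+-identityˡ 0#) ⟩
    0# ∷ (c ·ᵛ v +ᵛ linComb cs vs) ∎

  transpose : Vec (V k) d → Vec (V d) k
  transpose []       = Vec.replicate _ []
  transpose (v ∷ vs) = zipWith _∷_ v (transpose vs)

  -- A relation among the columns of a matrix is the same thing as a vector orthogonal to all its
  -- rows.
  linComb-transpose : (n : V k) (vs : Vec (V k) d) →
                      linComb n (transpose vs) ≡ Vec.map (dot n) vs
  -- With no rows the columns have length 0; the combination does not reduce for a variable `n`, but
  -- `[]` is the only vector it can be.
  linComb-transpose n []       = go (linComb n (Vec.replicate _ []))
    where
    go : (v : V 0) → v ≡ []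
    go [] = refl
  linComb-transpose n (v ∷ vs) =
    trans (linComb-∷ n v (transpose vs)) (cong (dot n v ∷_) (linComb-transpose n vs))

  -- The k columns have length d < k, hence are dependent; the coefficients of a relation form the
  -- vector sought.
  orthogonal : d ℕ.< k → (vs : Vec (V k) d) →
               ∃[ n ] n ≢ 0ᵛ × VecAll.All (λ v → dot n v ≡ 0#) vs
  orthogonal d<k vs with n , n≢0 , eq ← dependent d<k (transpose vs) =
    n , n≢0 , go vs (trans (sym (linComb-transpose n vs)) eq)
    where
    go : ∀ {e} (ws : Vec _ e) → Vec.map (dot n) ws ≡ 0ᵛ → VecAll.All (λ v → dot n v ≡ 0#) ws
    go []       _  = []
    go (w ∷ ws) eq with h , t ← ∷-injective eq = h ∷ go ws t

  -- Normalised vectors represent the points of projective space.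

  data Normalised : V k → Set where
    here  : ∀ {v : V k} → Normalised (1# ∷ v)
    there : ∀ {v : V k} → Normalised v → Normalised (0# ∷ v)

  -- The scalar is the inverse of the first non-zero coordinate. That it is non-zero is recorded so
  -- that membership can be transferred back along the scaling.
  normalise : (v : V k) → v ≢ 0ᵛ → ∃[ c ] c ≢ 0# × Normalised (c ·ᵛ v)
  normalise []      v≢0 = contradiction refl v≢0
  normalise (x ∷ v) v≢0 with x ≟ 0#
  ... | yes refl with c , c≢0 , n ← normalise v (v≢0 ∘ cong (0# ∷_)) =
    c , c≢0 , subst (λ y → Normalised (y ∷ c ·ᵛ v)) (sym (zeroʳ c)) (there n)
  ... | no x≢0 with c , xc≡1 ← inverse x x≢0 =
    c , c≢0 , subst (λ y → Normalised (y ∷ c ·ᵛ v)) (trans (sym xc≡1) (*-comm x c)) here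
    where
    c≢0 : c ≢ 0#
    c≢0 refl = 0≢1 (trans (sym (zeroʳ x)) xc≡1)

  -- The unit vector at the position of the leading 1 serves as `w`. It supplies a vector outside
  -- the hyperplane orthogonal to `n`.
  Normalised⇒dot≡1 : ∀ {n : V k} → Normalised n → ∃[ w ] dot n w ≡ 1#
  Normalised⇒dot≡1 {n = _ ∷ n} here =
    1# ∷ 0ᵛ , trans (cong₂ _+_ (*-identityˡ 1#) (dot-zeroʳ n)) (+-identityʳ 1#)
  Normalised⇒dot≡1 (there {v = n} p) with w , eq ← Normalised⇒dot≡1 p =
    0# ∷ w , trans (dot-0∷ n 0# w) eq

  allVectors? : ∀ {P : V k → Set} → Decidable P → Dec (∀ v → P v)
  allVectors? {zero}  P? = map′ (λ { p [] → p }) (λ f → f []) (P? [])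
  allVectors? {suc k} P? =
    map′ (λ { f (x ∷ v) → f x v }) (λ f x v → f (x ∷ v))
         (Fin.all? λ x → allVectors? λ v → P? (x ∷ v))

  -- Splitting on the leading coordinate, 1 before an arbitrary tail or 0 before a normalised one,
  -- visits one representative per projective point.
  allNormalised? : ∀ {P : V k → Set} → Decidable P → Dec (∀ v → Normalised v → P v)
  allNormalised? {zero}  P? = yes λ _ ()
  allNormalised? {suc k} P? =
    map′ (λ { (f , g) _ here → f _ ; (f , g) _ (there n) → g _ n })
         (λ f → (λ v → f _ here) , λ v n → f _ (there n))
         (allVectors? (λ v → P? (1# ∷ v)) ×-dec allNormalised? (λ v → P? (0# ∷ v)))

  -- Hyperplanes

  ∈-cancel : ∀ {S : Subspace k} {c v} → c ≢ 0# → c ·ᵛ v ∈ S → v ∈ S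
  ∈-cancel {S = S} {c} {v} c≢0 cv∈S with b , cb≡1 ← inverse c c≢0 =
    subst (_∈ S) eq (Subspace.·-closed S b cv∈S)
    where
    eq : b ·ᵛ c ·ᵛ v ≡ v
    eq = begin
      b ·ᵛ c ·ᵛ v   ≡⟨ ·ᵛ-assoc b c v ⟨
      (b * c) ·ᵛ v  ≡⟨ cong (_·ᵛ v) (trans (*-comm b c) cb≡1) ⟩
      1# ·ᵛ v       ≡⟨ ·ᵛ-identity v ⟩
      v             ∎

  IsNormal : V k → Subspace k → Set
  IsNormal n H = ∀ v → v ∈ H ⇔ dot n v ≡ 0#

  -- A non-zero vector orthogonal to the k - 1 basis vectors exists and can be scaled. The inclusion
  -- of its orthogonal space in `H` is a dimension count: `w`, `v` and the basis are k + 1 vectors,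
  -- hence dependent.
  hyperplane-normal : (H : Subspace k) → IsHyperplane H → ∃[ n ] Normalised n × IsNormal n H
  hyperplane-normal H 1+d≡k with m , m≢0 , m⊥ ← orthogonal (ℕ.≤-reflexive 1+d≡k) (Subspace.basis H)
                           with c , _ , norm ← normalise m m≢0
                           with w , nw≡1 ← Normalised⇒dot≡1 norm
    = n , norm , λ v → mk⇔ ⊆n^⊥ (n^⊥⊆ v)
    where
    B = Subspace.basis H
    n = c ·ᵛ m

    n⊥ : VecAll.All (λ v → dot n v ≡ 0#) B
    n⊥ = VecAll.map (λ {v} mv → trans (dot-·ˡ c m v) (trans (cong (c *_) mv) (zeroʳ c))) m⊥

    ⊆n^⊥ : ∀ {v} → v ∈ H → dot n v ≡ 0#
    ⊆n^⊥ v∈H with cs , refl ← Subspace.spanning H v∈H = dot-linComb n cs n⊥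

    -- A relation a w + b v + Σ cᵢ hᵢ = 0 has a = 0 on pairing with n, then b = 0 if v ∉ H.
    n^⊥⊆ : ∀ v → dot n v ≡ 0# → v ∈ H
    n^⊥⊆ v nv≡0 with v ∈? H
    ... | yes v∈H = v∈H
    ... | no v∉H with dependent (ℕ.s≤s (ℕ.≤-reflexive (sym 1+d≡k))) (w ∷ v ∷ B)
    ... | a ∷ b ∷ cs , ≢0 , rel = contradiction all-zero ≢0
      where
      nrest : dot n (b ·ᵛ v +ᵛ linComb cs B) ≡ 0#
      nrest = dot-linComb n (b ∷ cs) (nv≡0 ∷ n⊥)

      a≡0 : a ≡ 0#
      a≡0 = begin
        a                                           ≡⟨ *-identityʳ a ⟨
        a * 1#                                      ≡⟨ cong (a *_) nw≡1 ⟨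
        a * dot n w                                 ≡⟨ dot-·ʳ a n w ⟨
        dot n (a ·ᵛ w)                              ≡⟨ +-identityʳ _ ⟨
        dot n (a ·ᵛ w) + 0#                         ≡⟨ cong (_ +_) nrest ⟨
        dot n (a ·ᵛ w) + dot n (b ·ᵛ v +ᵛ linComb cs B)  ≡⟨ dot-+ʳ n _ _ ⟨
        dot n (linComb (a ∷ b ∷ cs) (w ∷ v ∷ B))    ≡⟨ cong (dot n) rel ⟩
        dot n 0ᵛ                                    ≡⟨ dot-zeroʳ n ⟩
        0#                                          ∎

      rel′ : b ·ᵛ v +ᵛ linComb cs B ≡ 0ᵛ
      rel′ = begin
        b ·ᵛ v +ᵛ linComb cs B                  ≡⟨ +ᵛ-identityˡ _ ⟨
        0ᵛ +ᵛ (b ·ᵛ v +ᵛ linComb cs B)          ≡⟨ cong (_+ᵛ (b ·ᵛ v +ᵛ linComb cs B)) (·ᵛ-zeroˡ w) ⟨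
        0# ·ᵛ w +ᵛ (b ·ᵛ v +ᵛ linComb cs B)     ≡⟨ cong (λ a → a ·ᵛ w +ᵛ (b ·ᵛ v +ᵛ linComb cs B)) a≡0 ⟨
        a ·ᵛ w +ᵛ (b ·ᵛ v +ᵛ linComb cs B)      ≡⟨ rel ⟩
        0ᵛ                                      ∎

      span-closed : ∀ ds → linComb ds B ∈ H
      span-closed ds = linComb-closed H ds (Subspace.basis⊆ H)

      -- The relation identifies `b ·ᵛ v` with the combination of the basis with coefficients
      -- `- cs`; comparing the two by subtraction produces the factor (-1)(-1).
      bv∈H : b ·ᵛ v ∈ H
      bv∈H = subst (_∈ H) (sym (u-v≡0⇒u≡v _ _ (begin
        b ·ᵛ v -ᵛ linComb ((- 1#) ·ᵛ cs) B    ≡⟨ cong (b ·ᵛ v -ᵛ_) (linComb-· (- 1#) cs B) ⟩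
        b ·ᵛ v +ᵛ (- 1#) ·ᵛ (- 1#) ·ᵛ linComb cs B
          ≡⟨ cong (b ·ᵛ v +ᵛ_) (·ᵛ-assoc (- 1#) (- 1#) _) ⟨
        b ·ᵛ v +ᵛ ((- 1#) * (- 1#)) ·ᵛ linComb cs B
          ≡⟨ cong (λ c → b ·ᵛ v +ᵛ c ·ᵛ linComb cs B) -1*-1≡1 ⟩
        b ·ᵛ v +ᵛ 1# ·ᵛ linComb cs B          ≡⟨ cong (b ·ᵛ v +ᵛ_) (·ᵛ-identity _) ⟩
        b ·ᵛ v +ᵛ linComb cs B                ≡⟨ rel′ ⟩
        0ᵛ                                    ∎))) (span-closed ((- 1#) ·ᵛ cs))
        where
        -1*-1≡1 : (- 1#) * (- 1#) ≡ 1#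
        -1*-1≡1 = trans (sym (-‿distribˡ-* 1# _)) (trans (cong -_ (*-identityˡ _)) (-‿involutive 1#))

      b≡0 : b ≡ 0#
      b≡0 with b ≟ 0#
      ... | yes eq = eq
      ... | no b≢0 = contradiction (∈-cancel {S = H} b≢0 bv∈H) v∉H

      cs≡0 : cs ≡ 0ᵛ
      cs≡0 = Subspace.independent H cs (begin
        linComb cs B                  ≡⟨ +ᵛ-identityˡ _ ⟨
        0ᵛ +ᵛ linComb cs B            ≡⟨ cong (_+ᵛ linComb cs B) (·ᵛ-zeroˡ v) ⟨
        0# ·ᵛ v +ᵛ linComb cs B       ≡⟨ cong (λ b → b ·ᵛ v +ᵛ linComb cs B) b≡0 ⟨
        b ·ᵛ v +ᵛ linComb cs B        ≡⟨ rel′ ⟩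
        0ᵛ                            ∎)

      all-zero : a ∷ b ∷ cs ≡ 0ᵛ
      all-zero = cong₂ _∷_ a≡0 (cong₂ _∷_ b≡0 cs≡0)

  -- Echelon subspaces and the two counting conditions.

  module Counting (_⊥?_ : ∀ {k} (u v : V k) → Dec (dot u v ≡ 0#)) where

    -- Subspaces in reduced echelon form, read from the last coordinate: a coordinate is
    -- either free or a prescribed linear function of the free coordinates to its right.

    data Echelon : ℕ → ℕ → Set where
      []   : Echelon 0 0
      free : Echelon k d → Echelon (suc k) (suc d)
      dep  : V d → Echelon k d → Echelon (suc k) d

    freeCoords : Echelon k d → V k → V d
    freeCoords []        []      = []
    freeCoords (free E)  (x ∷ v) = x ∷ freeCoords E v
    freeCoords (dep _ E) (_ ∷ v) = freeCoords E v

    -- The adjoint of `freeCoords` for the standard form: a linear form in the free coordinates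
    -- becomes one in all coordinates.
    pullback : Echelon k d → V d → V k
    pullback []        []      = []
    pullback (free E)  (x ∷ c) = x ∷ pullback E c
    pullback (dep _ E) c       = 0# ∷ pullback E c

    -- The free coordinates of the i-th basis vector form the i-th unit vector, so its value at a
    -- dependent coordinate is the i-th entry of `c`.
    echelonBasis : Echelon k d → Vec (V k) d
    echelonBasis []        = []
    echelonBasis (free E)  = (1# ∷ 0ᵛ) ∷ Vec.map (0# ∷_) (echelonBasis E)
    echelonBasis (dep c E) = zipWith _∷_ c (echelonBasis E)

    -- One equation per dependent coordinate: that coordinate minus its prescribed combination of
    -- free coordinates vanishes.
    equations : Echelon k d → List (V k)
    equations []        = []
    equations (free E)  = map (0# ∷_) (equations E)
    equations (dep c E) = (1# ∷ pullback E ((- 1#) ·ᵛ c)) ∷ map (0# ∷_) (equations E)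

    Solves : List (V k) → V k → Set
    Solves ns v = All (λ n → dot n v ≡ 0#) ns

    -- The orthogonality test is a parameter of the module, so that a fast one can replace generic
    -- field arithmetic when membership is evaluated.
    solves? : (ns : List (V k)) → Decidable (Solves ns)
    solves? ns v = All.all? (_⊥? v) ns

    Solves-0∷⁺ : ∀ {ns : List (V k)} {x v} → Solves ns v → Solves (map (0# ∷_) ns) (x ∷ v)
    Solves-0∷⁺ {x = x} {v} = All.map⁺ ∘ All.map (λ {n} → trans (dot-0∷ n x v))

    Solves-0∷⁻ : ∀ {ns : List (V k)} {x v} → Solves (map (0# ∷_) ns) (x ∷ v) → Solves ns v
    Solves-0∷⁻ {x = x} {v} = All.map (λ {n} → trans (sym (dot-0∷ n x v))) ∘ All.map⁻

    dot-pullback : ∀ (E : Echelon k d) c v → dot (pullback E c) v ≡ dot c (freeCoords E v)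
    dot-pullback []        []      []      = refl
    dot-pullback (free E)  (x ∷ c) (y ∷ v) = cong (x * y +_) (dot-pullback E c v)
    dot-pullback (dep _ E) c       (y ∷ v) = trans (dot-0∷ (pullback E c) y v) (dot-pullback E c v)

    dep-equation : ∀ (E : Echelon k d) c x v →
                   dot (1# ∷ pullback E ((- 1#) ·ᵛ c)) (x ∷ v) ≡ x + - dot c (freeCoords E v)
    dep-equation E c x v = cong₂ _+_ (*-identityˡ x) (begin
      dot (pullback E ((- 1#) ·ᵛ c)) v     ≡⟨ dot-pullback E _ v ⟩
      dot ((- 1#) ·ᵛ c) (freeCoords E v)   ≡⟨ dot-·ˡ (- 1#) c _ ⟩
      (- 1#) * dot c (freeCoords E v)      ≡⟨ -1*x≈-x _ ⟩
      - dot c (freeCoords E v)             ∎)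

    linComb-free : ∀ x cs (E : Echelon k d) →
                   linComb (x ∷ cs) (echelonBasis (free E)) ≡ x ∷ linComb cs (echelonBasis E)
    linComb-free x cs E = begin
      (x * 1# ∷ x ·ᵛ 0ᵛ) +ᵛ linComb cs (Vec.map (0# ∷_) (echelonBasis E))
        ≡⟨ cong₂ _+ᵛ_ (cong₂ _∷_ (*-identityʳ x) (·ᵛ-zeroʳ x)) (linComb-0∷ cs (echelonBasis E)) ⟩
      (x + 0#) ∷ (0ᵛ +ᵛ linComb cs (echelonBasis E))
        ≡⟨ cong₂ _∷_ (+-identityʳ x) (+ᵛ-identityˡ _) ⟩
      x ∷ linComb cs (echelonBasis E) ∎

    -- The coefficients can be read off a combination, which gives independence of the echelon
    -- basis.
    freeCoords-linComb : ∀ cs (E : Echelon k d) → freeCoords E (linComb cs (echelonBasis E)) ≡ cs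
    freeCoords-linComb []       []        = refl
    freeCoords-linComb (x ∷ cs) (free E)
      rewrite linComb-free x cs E = cong (x ∷_) (freeCoords-linComb cs E)
    freeCoords-linComb cs       (dep c E)
      rewrite linComb-∷ cs c (echelonBasis E) = freeCoords-linComb cs E

    freeCoords-0 : (E : Echelon k d) → freeCoords E 0ᵛ ≡ 0ᵛ
    freeCoords-0 []        = refl
    freeCoords-0 (free E)  = cong (0# ∷_) (freeCoords-0 E)
    freeCoords-0 (dep _ E) = freeCoords-0 E

    linComb-solves : ∀ cs (E : Echelon k d) → Solves (equations E) (linComb cs (echelonBasis E))
    linComb-solves []       []        = []
    linComb-solves (x ∷ cs) (free E)
      rewrite linComb-free x cs E = Solves-0∷⁺ (linComb-solves cs E)
    linComb-solves cs       (dep c E)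
      rewrite linComb-∷ cs c (echelonBasis E) = head ∷ Solves-0∷⁺ (linComb-solves cs E)
      where
      v = linComb cs (echelonBasis E)

      head : dot (1# ∷ pullback E ((- 1#) ·ᵛ c)) (dot cs c ∷ v) ≡ 0#
      head = begin
        dot (1# ∷ pullback E ((- 1#) ·ᵛ c)) (dot cs c ∷ v)
          ≡⟨ dep-equation E c (dot cs c) v ⟩
        dot cs c + - dot c (freeCoords E v)
          ≡⟨ cong₂ (λ a u → a + - dot c u) (dot-comm cs c) (freeCoords-linComb cs E) ⟩
        dot c cs + - dot c cs
          ≡⟨ -‿inverseʳ _ ⟩
        0# ∎

    -- A solution is determined by its free coordinates, which therefore serve as its coefficients;
    -- this is the spanning property.
    solution-linComb : ∀ (E : Echelon k d) v → Solves (equations E) v →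
                       v ≡ linComb (freeCoords E v) (echelonBasis E)
    solution-linComb []        []      _  = refl
    solution-linComb (free E)  (x ∷ v) ps = sym (trans (linComb-free x (freeCoords E v) E)
      (cong (x ∷_) (sym (solution-linComb E v (Solves-0∷⁻ ps)))))
    solution-linComb (dep c E) (x ∷ v) (p ∷ ps) =
      sym (trans (linComb-∷ (freeCoords E v) c (echelonBasis E))
        (cong₂ _∷_ (sym x≡) (sym (solution-linComb E v (Solves-0∷⁻ ps)))))
      where
      x≡ : x ≡ dot (freeCoords E v) c
      x≡ = trans (x∙y⁻¹≈ε⇒x≈y _ _ (trans (sym (dep-equation E c x v)) p)) (dot-comm c _)

    -- Each vector is the combination with a unit coefficient vector, so a property of all
    -- combinations passes to the basis itself.
    All-linComb : ∀ {P : V k → Set} (vs : Vec (V k) d) → (∀ cs → P (linComb cs vs)) → VecAll.All P vs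
    All-linComb         []       _   = []
    All-linComb {P = P} (v ∷ vs) all =
        subst P (begin
          1# ·ᵛ v +ᵛ linComb 0ᵛ vs  ≡⟨ cong₂ _+ᵛ_ (·ᵛ-identity v) (linComb-0 vs) ⟩
          v +ᵛ 0ᵛ                   ≡⟨ +ᵛ-identityʳ v ⟩
          v                         ∎) (all (1# ∷ 0ᵛ))
      ∷ All-linComb vs λ cs → subst P (begin
          0# ·ᵛ v +ᵛ linComb cs vs  ≡⟨ cong (_+ᵛ linComb cs vs) (·ᵛ-zeroˡ v) ⟩
          0ᵛ +ᵛ linComb cs vs       ≡⟨ +ᵛ-identityˡ _ ⟩
          linComb cs vs             ∎) (all (0# ∷ cs))

    -- Membership means solving the equations rather than lying in a span, so deciding it takes only
    -- k - d dot products.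
    subspace : Echelon k d → Subspace k
    subspace {k} {d} E = record
      { Mem         = Solves (equations E)
      ; mem?        = solves? (equations E)
      ; 0-closed    = All.universal dot-zeroʳ (equations E)
      ; +-closed    = λ ps qs → All.zipWith (λ {n} (p , q) → dot-+-closed n p q) (ps , qs)
      ; ·-closed    = λ c → All.map (λ {n} → dot-·-closed n c)
      ; dim         = d
      ; basis       = echelonBasis E
      ; basis⊆      = All-linComb (echelonBasis E) (λ cs → linComb-solves cs E)
      ; independent = λ cs eq → trans (sym (freeCoords-linComb cs E))
                                      (trans (cong (freeCoords E) eq) (freeCoords-0 E))
      ; spanning    = λ {v} ps → freeCoords E v , solution-linComb E v ps
      }

    -- Reduction of both counts to normalised vectors.

    Annihilates : V k → Subspace k → Set
    Annihilates n S = VecAll.All (λ b → dot n b ≡ 0#) (Subspace.basis S)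

    annihilates? : (n : V k) → Decidable (Annihilates n)
    annihilates? n S = VecAll.all? (n ⊥?_) (Subspace.basis S)

    -- Containment in the hyperplane orthogonal to `n` can be tested on a basis, and the count
    -- depends only on which subspaces pass the test.
    #ContainedIn-normal : ∀ {n : V k} {H} → IsNormal n H → ∀ 𝒮 →
                          #ContainedIn 𝒮 H ≡ List.length (List.filter (annihilates? n) 𝒮)
    #ContainedIn-normal {n = n} {H} norm 𝒮 =
      cong List.length (filter-≐ (_⊆? H) (annihilates? n) ((λ {S} → to {S}) , (λ {S} → from {S})) 𝒮)
      where
      to : ∀ {S} → S ⊆ H → Annihilates n S
      to {S} S⊆H = VecAll.map (λ b∈S → Equivalence.to (norm _) (S⊆H b∈S)) (Subspace.basis⊆ S)

      from : ∀ {S} → Annihilates n S → S ⊆ H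
      from {S} ann v∈S with cs , refl ← Subspace.spanning S v∈S =
        Equivalence.from (norm _) (dot-linComb n cs ann)

    -- Replacing a hyperplane by its normal turns a statement about abstract subspaces into one
    -- about finitely many vectors.
    hyperplanes-contain : ∀ m (𝒮 : List (Subspace k)) →
      (∀ n → Normalised n → List.length (List.filter (annihilates? n) 𝒮) ≡ m) →
      ∀ H → IsHyperplane H → #ContainedIn 𝒮 H ≡ m
    hyperplanes-contain m 𝒮 count H hyp with n , norm , normal ← hyperplane-normal H hyp =
      trans (#ContainedIn-normal {n = n} {H} normal 𝒮) (count n norm)

    weight : (Subspace k → ℕ) → List (Subspace k) → V k → ℕ
    weight w 𝒮 v = sum (map w (List.filter (v ∈?_) 𝒮))

    -- Every subspace contains `v` exactly when it contains a given non-zero multiple of `v`, so the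
    -- weight is a function of the projective point.
    weight-constant : ∀ (w : Subspace k → ℕ) 𝒮 μ → (∀ v → Normalised v → weight w 𝒮 v ≡ μ) →
                      ∀ v → v ≢ 0ᵛ → weight w 𝒮 v ≡ μ
    weight-constant w 𝒮 μ const v v≢0 with c , c≢0 , norm ← normalise v v≢0 = trans
      (cong (sum ∘ map w)
        (filter-≐ (v ∈?_) (c ·ᵛ v ∈?_)
          ((λ {S} → Subspace.·-closed S c {v}) , (λ {S} → ∈-cancel {S = S} c≢0)) 𝒮))
      (const (c ·ᵛ v) norm)

-- Evaluation over the field with five elements.

open LinearAlgebra 𝔽₅ using (Subspace; dim; IsHyperplane; #ContainedIn; IsMultispread; V)
open FiniteLinearAlgebra 𝔽₅

dotℕ : ∀ {k} → V k → V k → ℕ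
dotℕ []      []      = 0
dotℕ (x ∷ u) (y ∷ v) = toℕ x ℕ.* toℕ y ℕ.+ dotℕ u v

toℕ-mod : ∀ m → toℕ (m mod 5) ≡ m % 5
toℕ-mod m = toℕ-fromℕ< _

-- Reductions modulo 5 can be postponed to the end, so a single one suffices for the whole dot
-- product.
toℕ-dot : ∀ {k} (u v : V k) → toℕ (dot u v) ≡ dotℕ u v % 5
toℕ-dot []      []      = refl
toℕ-dot (x ∷ u) (y ∷ v) = begin
  toℕ (x * y + dot u v)
    ≡⟨ toℕ-mod (toℕ (x * y) ℕ.+ toℕ (dot u v)) ⟩
  (toℕ (x * y) ℕ.+ toℕ (dot u v)) % 5
    ≡⟨ cong₂ (λ a b → (a ℕ.+ b) % 5) (toℕ-mod (toℕ x ℕ.* toℕ y)) (toℕ-dot u v) ⟩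
  ((toℕ x ℕ.* toℕ y) % 5 ℕ.+ dotℕ u v % 5) % 5
    ≡⟨ %-distribˡ-+ (toℕ x ℕ.* toℕ y) (dotℕ u v) 5 ⟨
  (toℕ x ℕ.* toℕ y ℕ.+ dotℕ u v) % 5 ∎
  where
  open ≡-Reasoning
  open FiniteField 𝔽₅

-- Built-in arithmetic makes this much faster to evaluate than dot itself.
_⊥?_ : ∀ {k} (u v : V k) → Dec (dot u v ≡ Fin.zero)
u ⊥? v = map′ (λ eq → toℕ-injective (trans (toℕ-dot u v) eq))
              (λ eq → trans (sym (toℕ-dot u v)) (cong toℕ eq))
              (dotℕ u v % 5 ℕ.≟ 0)

open Counting _⊥?_

-- Checking the premise by `refl` evaluates only the Boolean of the decision and leaves its proof
-- part alone.
from-does : ∀ {ℓ} {A : Set ℓ} (A? : Dec A) → does A? ≡ true → A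
from-does (yes a) refl = a

contained? : ∀ {k} m (𝒮 : List (Subspace k)) →
             Dec (∀ n → Normalised n → List.length (List.filter (annihilates? n) 𝒮) ≡ m)
contained? m 𝒮 = allNormalised? λ n → List.length (List.filter (annihilates? n) 𝒮) ℕ.≟ m

covered? : ∀ {k} w μ (𝒮 : List (Subspace k)) → Dec (∀ v → Normalised v → weight w 𝒮 v ≡ μ)
covered? w μ 𝒮 = allNormalised? λ v → weight w 𝒮 v ℕ.≟ μ

-- Multispreads from finite checks.

MultispreadOfType : (a b lam μ : ℕ) → Set₁
MultispreadOfType a b lam μ =
  Σ[ 𝒮 ∈ List (Subspace 5) ]
      map dim 𝒮 ↭ replicate a 2 ++ replicate b 3
    × (∀ (H : Subspace 5) → IsHyperplane H → #ContainedIn 𝒮 H ≡ 2)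
    × IsMultispread lam μ 3 5 𝒮

-- For a concrete list every premise is a closed computation; the two counting premises range over
-- normalised vectors only.
multispread : ∀ a b lam μ (𝒮 : List (Subspace 5)) →
              map dim 𝒮 ≡ replicate a 2 ++ replicate b 3 →
              does (All.all? (λ S → dim S ℕ.≤? 3) 𝒮) ≡ true →
              sum (map (λ S → 5 ^ (3 ∸ dim S) ∸ 1) 𝒮) ≡ lam →
              does (contained? 2 𝒮) ≡ true →
              does (covered? (λ S → 5 ^ (3 ∸ dim S)) μ 𝒮) ≡ true →
              MultispreadOfType a b lam μ
multispread a b lam μ 𝒮 dims dim≤3 excess contained covered =
  𝒮 , ↭-reflexive dims , hyperplanes-contain 2 𝒮 (from-does (contained? 2 𝒮) contained) , record
  { dim≤h  = from-does (All.all? (λ S → dim S ℕ.≤? 3) 𝒮) dim≤3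
  ; cover  = weight-constant w 𝒮 μ (from-does (covered? w μ 𝒮) covered)
  ; excess = excess
  }
  where
  w : Subspace 5 → ℕ
  w S = 5 ^ (3 ∸ dim S)

-- The coefficients of a dependent coordinate are written as the decimal digits of one
-- number; the last digit of m is m mod 5 as long as it is less than 5.

digits : ∀ d → ℕ → Vec (Fin 5) d
digits zero    _ = []
digits (suc d) m = digits d (m / 10) ∷ʳ (m mod 5)

infixr 6 _▹_
-- The number of free coordinates to the right fixes how many digits are read, so leading zeros are
-- harmless. For example, `43 ▹ 12 ▹ 10 ▹ full 2` is given by x₁ = 4x₄ + 3x₅, x₂ = x₄ + 2x₅, x₃ =
-- x₄, while `0 ▹ []` is a coordinate that vanishes.
_▹_ : ∀ {k d} → ℕ → Echelon k d → Echelon (suc k) d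
m ▹ E = dep (digits _ m) E

full : ∀ n → Echelon n n
full zero    = []
full (suc n) = free (full n)

-- Family (a): 20 two-dimensional and 157 three-dimensional subspaces.

twoDimᵃ : List (Echelon 5 2)
twoDimᵃ =
    43 ▹ 12 ▹ 10 ▹ full 2 ∷ 22 ▹ 40 ▹ free (1 ▹ full 1) ∷ 22 ▹ 10 ▹ free (4 ▹ full 1) ∷
    13 ▹ 13 ▹ 40 ▹ full 2 ∷ 31 ▹ 43 ▹ 31 ▹ full 2 ∷ 31 ▹ free (1 ▹ 2 ▹ full 1) ∷
    42 ▹ 41 ▹ 32 ▹ full 2 ∷ 12 ▹ 44 ▹ 22 ▹ full 2 ∷ 11 ▹ 34 ▹ 30 ▹ full 2 ∷
    22 ▹ 12 ▹ 03 ▹ full 2 ∷ 41 ▹ 31 ▹ 20 ▹ full 2 ∷ 12 ▹ 41 ▹ 31 ▹ full 2 ∷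
    32 ▹ 13 ▹ 03 ▹ full 2 ∷ 42 ▹ 44 ▹ 21 ▹ full 2 ∷ 21 ▹ free (1 ▹ 3 ▹ full 1) ∷
    21 ▹ 42 ▹ 21 ▹ full 2 ∷ 24 ▹ 43 ▹ 04 ▹ full 2 ∷ 40 ▹ 32 ▹ free (3 ▹ full 1) ∷
    40 ▹ 23 ▹ free (2 ▹ full 1) ∷ 34 ▹ 42 ▹ 04 ▹ full 2 ∷ []

threeDimᵃ : List (Echelon 5 3)
threeDimᵃ =
    -- This subspace has multiplicity two, so a hyperplane containing it contains no other member of
    -- the family.
    004 ▹ free (00 ▹ full 2) ∷ 004 ▹ free (00 ▹ full 2) ∷ free (00 ▹ free (0 ▹ full 1)) ∷
    001 ▹ 010 ▹ full 3 ∷ 001 ▹ 040 ▹ full 3 ∷ 013 ▹ free (free (0 ▹ full 1)) ∷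
    302 ▹ 000 ▹ full 3 ∷ 212 ▹ 432 ▹ full 3 ∷ 242 ▹ 133 ▹ full 3 ∷
    100 ▹ free (free (4 ▹ full 1)) ∷ 400 ▹ free (free (1 ▹ full 1)) ∷ 302 ▹ 030 ▹ full 3 ∷
    103 ▹ 020 ▹ full 3 ∷ 310 ▹ 201 ▹ full 3 ∷ 340 ▹ 304 ▹ full 3 ∷ 033 ▹ 031 ▹ full 3 ∷
    023 ▹ 034 ▹ full 3 ∷ free (32 ▹ 44 ▹ full 2) ∷ 210 ▹ 310 ▹ full 3 ∷ 034 ▹ free (12 ▹ full 2) ∷
    024 ▹ free (42 ▹ full 2) ∷ 402 ▹ 204 ▹ full 3 ∷ 130 ▹ free (42 ▹ full 2) ∷
    402 ▹ 301 ▹ full 3 ∷ 341 ▹ 032 ▹ full 3 ∷ 420 ▹ free (12 ▹ full 2) ∷ 311 ▹ 033 ▹ full 3 ∷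
    240 ▹ 210 ▹ full 3 ∷ free (33 ▹ 14 ▹ full 2) ∷ 402 ▹ free (02 ▹ full 2) ∷
    023 ▹ free (41 ▹ full 2) ∷ 311 ▹ 233 ▹ full 3 ∷ 341 ▹ 332 ▹ full 3 ∷
    114 ▹ free (34 ▹ full 2) ∷ 340 ▹ 124 ▹ full 3 ∷ 444 ▹ free (24 ▹ full 2) ∷
    243 ▹ 304 ▹ full 3 ∷ 310 ▹ 421 ▹ full 3 ∷ 213 ▹ 201 ▹ full 3 ∷ 033 ▹ free (11 ▹ full 2) ∷
    102 ▹ free (02 ▹ full 2) ∷ 422 ▹ 004 ▹ full 3 ∷ 010 ▹ 212 ▹ full 3 ∷ 342 ▹ 322 ▹ full 3 ∷
    312 ▹ 223 ▹ full 3 ∷ 142 ▹ 022 ▹ full 3 ∷ 003 ▹ 324 ▹ full 3 ∷ 112 ▹ 023 ▹ full 3 ∷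
    002 ▹ 131 ▹ full 3 ∷ 003 ▹ 221 ▹ full 3 ∷ 002 ▹ 434 ▹ full 3 ∷ 040 ▹ 313 ▹ full 3 ∷
    432 ▹ 001 ▹ full 3 ∷ 113 ▹ free (43 ▹ full 2) ∷ 111 ▹ 322 ▹ full 3 ∷ 401 ▹ 022 ▹ full 3 ∷
    401 ▹ 023 ▹ full 3 ∷ 101 ▹ 131 ▹ full 3 ∷ 440 ▹ 113 ▹ full 3 ∷ 101 ▹ 434 ▹ full 3 ∷
    022 ▹ 404 ▹ full 3 ∷ 410 ▹ 412 ▹ full 3 ∷ 032 ▹ 101 ▹ full 3 ∷ 141 ▹ 223 ▹ full 3 ∷
    443 ▹ free (13 ▹ full 2) ∷ 322 ▹ free (free (free (0 ▹ []))) ∷ 000 ▹ 112 ▹ full 3 ∷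
    102 ▹ 243 ▹ full 3 ∷ 102 ▹ 342 ▹ full 3 ∷ 203 ▹ 241 ▹ full 3 ∷ 314 ▹ 140 ▹ full 3 ∷
    203 ▹ 344 ▹ full 3 ∷ 444 ▹ 140 ▹ full 3 ∷ 344 ▹ 440 ▹ full 3 ∷ 414 ▹ 440 ▹ full 3 ∷
    000 ▹ 413 ▹ full 3 ∷ 223 ▹ free (free (free (0 ▹ []))) ∷ 314 ▹ 404 ▹ full 3 ∷
    410 ▹ 444 ▹ full 3 ∷ 111 ▹ 330 ▹ full 3 ∷ 141 ▹ 230 ▹ full 3 ∷ 021 ▹ 120 ▹ full 3 ∷
    011 ▹ 243 ▹ full 3 ∷ 031 ▹ 420 ▹ full 3 ∷ 244 ▹ 312 ▹ full 3 ∷ 041 ▹ 342 ▹ full 3 ∷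
    214 ▹ 213 ▹ full 3 ∷ 440 ▹ 141 ▹ full 3 ∷ 344 ▹ 101 ▹ full 3 ∷ 432 ▹ 003 ▹ full 3 ∷
    030 ▹ 323 ▹ full 3 ∷ 112 ▹ 113 ▹ full 3 ∷ 142 ▹ 412 ▹ full 3 ∷ 044 ▹ 132 ▹ full 3 ∷
    222 ▹ 214 ▹ full 3 ∷ 014 ▹ 433 ▹ full 3 ∷ 324 ▹ 134 ▹ full 3 ∷ 232 ▹ 311 ▹ full 3 ∷
    334 ▹ 431 ▹ full 3 ∷ 020 ▹ 222 ▹ full 3 ∷ 422 ▹ 002 ▹ full 3 ∷ 222 ▹ 003 ▹ full 3 ∷
    030 ▹ 132 ▹ full 3 ∷ 232 ▹ 002 ▹ full 3 ∷ 020 ▹ 433 ▹ full 3 ∷ 110 ▹ 403 ▹ full 3 ∷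
    230 ▹ 104 ▹ full 3 ∷ 420 ▹ 134 ▹ full 3 ∷ 430 ▹ 431 ▹ full 3 ∷ 014 ▹ 202 ▹ full 3 ∷
    013 ▹ 323 ▹ full 3 ∷ 044 ▹ 303 ▹ full 3 ∷ 134 ▹ 214 ▹ full 3 ∷ 043 ▹ 222 ▹ full 3 ∷
    124 ▹ 311 ▹ full 3 ∷ 220 ▹ 401 ▹ full 3 ∷ 140 ▹ 102 ▹ full 3 ∷ 310 ▹ free (40 ▹ full 2) ∷
    free (24 ▹ 24 ▹ full 2) ∷ 114 ▹ 141 ▹ full 3 ∷ 144 ▹ 444 ▹ full 3 ∷ 422 ▹ free (23 ▹ full 2) ∷
    free (11 ▹ 41 ▹ full 2) ∷ 132 ▹ free (33 ▹ full 2) ∷ 330 ▹ 230 ▹ full 3 ∷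
    free (14 ▹ 11 ▹ full 2) ∷ 320 ▹ 330 ▹ full 3 ∷ free (21 ▹ 34 ▹ full 2) ∷
    240 ▹ free (10 ▹ full 2) ∷ 410 ▹ free (33 ▹ full 2) ∷ 214 ▹ 014 ▹ full 3 ∷
    320 ▹ 443 ▹ full 3 ∷ 330 ▹ 142 ▹ full 3 ∷ 431 ▹ 402 ▹ full 3 ∷ 144 ▹ 302 ▹ full 3 ∷
    421 ▹ 103 ▹ full 3 ∷ 130 ▹ 024 ▹ full 3 ∷ 114 ▹ 203 ▹ full 3 ∷ 120 ▹ 021 ▹ full 3 ∷
    244 ▹ 011 ▹ full 3 ∷ 140 ▹ free (23 ▹ full 2) ∷ 312 ▹ 004 ▹ full 3 ∷ 010 ▹ 324 ▹ full 3 ∷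
    342 ▹ 001 ▹ full 3 ∷ 040 ▹ 221 ▹ full 3 ∷ 321 ▹ 424 ▹ full 3 ∷ 333 ▹ 341 ▹ full 3 ∷
    323 ▹ 244 ▹ full 3 ∷ 331 ▹ 121 ▹ full 3 ∷ 322 ▹ 430 ▹ full 3 ∷ 423 ▹ 320 ▹ full 3 ∷
    332 ▹ 130 ▹ full 3 ∷ 433 ▹ 220 ▹ full 3 ∷ 143 ▹ 430 ▹ full 3 ∷ 212 ▹ 320 ▹ full 3 ∷
    242 ▹ 220 ▹ full 3 ∷ 113 ▹ 130 ▹ full 3 ∷ []

𝒮ᵃ : List (Subspace 5)
𝒮ᵃ = map subspace twoDimᵃ ++ map subspace threeDimᵃ

-- Family (b): 14 two-dimensional and 188 three-dimensional subspaces.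

twoDimᵇ : List (Echelon 5 2)
twoDimᵇ =
    41 ▹ 03 ▹ 41 ▹ full 2 ∷ 13 ▹ 30 ▹ 32 ▹ full 2 ∷ 14 ▹ 22 ▹ 00 ▹ full 2 ∷
    04 ▹ 02 ▹ 11 ▹ full 2 ∷ 34 ▹ 41 ▹ 44 ▹ full 2 ∷ 13 ▹ 01 ▹ 21 ▹ full 2 ∷
    10 ▹ 20 ▹ 34 ▹ full 2 ∷ 34 ▹ 10 ▹ free (free (0 ▹ [])) ∷ 12 ▹ 10 ▹ 21 ▹ full 2 ∷
    20 ▹ 13 ▹ 24 ▹ full 2 ∷ 43 ▹ 43 ▹ 44 ▹ full 2 ∷ 03 ▹ 12 ▹ 32 ▹ full 2 ∷
    21 ▹ 34 ▹ 02 ▹ full 2 ∷ 03 ▹ 21 ▹ 02 ▹ full 2 ∷ []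

threeDimᵇ : List (Echelon 5 3)
threeDimᵇ =
    -- The first 31 entries are the annihilators of the traded lines 𝔽₅² ⊗ y, where y = (a, b, c)
    -- gives the span of a e₁ + b e₃ + c e₄ and a e₂ + b e₄ + c e₅. The projection sends two of the
    -- six basis tensors to e₄; its kernel contains no non-zero pure tensor, so these lines and the
    -- six planes cover the same points equally often. The trade changes 20 and 157 into 20 - 6 = 14
    -- and 157 + 31 = 188.
    000 ▹ 000 ▹ full 3 ∷ free (free (free (0 ▹ 0 ▹ []))) ∷ 040 ▹ 004 ▹ full 3 ∷
    020 ▹ 002 ▹ full 3 ∷ 030 ▹ 003 ▹ full 3 ∷ 010 ▹ 001 ▹ full 3 ∷ free (free (0 ▹ 0 ▹ full 1)) ∷
    400 ▹ 040 ▹ full 3 ∷ 200 ▹ 020 ▹ full 3 ∷ 300 ▹ 030 ▹ full 3 ∷ 100 ▹ 010 ▹ full 3 ∷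
    free (free (1 ▹ 4 ▹ full 1)) ∷ 440 ▹ 044 ▹ full 3 ∷ 220 ▹ 022 ▹ full 3 ∷ 330 ▹ 033 ▹ full 3 ∷
    110 ▹ 011 ▹ full 3 ∷ free (free (4 ▹ 3 ▹ full 1)) ∷ 430 ▹ 043 ▹ full 3 ∷ 240 ▹ 024 ▹ full 3 ∷
    310 ▹ 031 ▹ full 3 ∷ 120 ▹ 012 ▹ full 3 ∷ free (free (4 ▹ 2 ▹ full 1)) ∷ 420 ▹ 042 ▹ full 3 ∷
    210 ▹ 021 ▹ full 3 ∷ 340 ▹ 034 ▹ full 3 ∷ 130 ▹ 013 ▹ full 3 ∷ free (free (1 ▹ 1 ▹ full 1)) ∷
    410 ▹ 041 ▹ full 3 ∷ 230 ▹ 023 ▹ full 3 ∷ 320 ▹ 032 ▹ full 3 ∷ 140 ▹ 014 ▹ full 3 ∷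
    112 ▹ 032 ▹ full 3 ∷ 343 ▹ 334 ▹ full 3 ∷ 021 ▹ 214 ▹ full 3 ∷ 301 ▹ 320 ▹ full 3 ∷
    031 ▹ 210 ▹ full 3 ∷ 301 ▹ 242 ▹ full 3 ∷ 103 ▹ free (03 ▹ full 2) ∷
    420 ▹ free (13 ▹ full 2) ∷ 201 ▹ 004 ▹ full 3 ∷ free (24 ▹ 43 ▹ full 2) ∷ 111 ▹ 143 ▹ full 3 ∷
    123 ▹ 300 ▹ full 3 ∷ 023 ▹ 342 ▹ full 3 ∷ 203 ▹ 114 ▹ full 3 ∷ 224 ▹ 244 ▹ full 3 ∷
    234 ▹ 240 ▹ full 3 ∷ 203 ▹ 310 ▹ full 3 ∷ 033 ▹ 142 ▹ full 3 ∷ 024 ▹ 441 ▹ full 3 ∷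
    002 ▹ 402 ▹ full 3 ∷ 024 ▹ 414 ▹ full 3 ∷ 123 ▹ 243 ▹ full 3 ∷ 222 ▹ 441 ▹ full 3 ∷
    002 ▹ 424 ▹ full 3 ∷ 042 ▹ 423 ▹ full 3 ∷ 443 ▹ 023 ▹ full 3 ∷ 342 ▹ 234 ▹ full 3 ∷
    231 ▹ 442 ▹ full 3 ∷ 404 ▹ 200 ▹ full 3 ∷ 034 ▹ 113 ▹ full 3 ∷ 404 ▹ 203 ▹ full 3 ∷
    341 ▹ 040 ▹ full 3 ∷ 402 ▹ 330 ▹ full 3 ∷ 143 ▹ 421 ▹ full 3 ∷ 110 ▹ 341 ▹ full 3 ∷
    130 ▹ 430 ▹ full 3 ∷ 324 ▹ 223 ▹ full 3 ∷ 424 ▹ 403 ▹ full 3 ∷ 332 ▹ 434 ▹ full 3 ∷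
    243 ▹ 403 ▹ full 3 ∷ 433 ▹ 120 ▹ full 3 ∷ 313 ▹ 410 ▹ full 3 ∷ 113 ▹ 440 ▹ full 3 ∷
    110 ▹ free (31 ▹ full 2) ∷ 441 ▹ free (22 ▹ full 2) ∷ 333 ▹ 443 ▹ full 3 ∷
    free (42 ▹ 14 ▹ full 2) ∷ 023 ▹ 314 ▹ full 3 ∷ 221 ▹ 123 ▹ full 3 ∷ 212 ▹ free (31 ▹ full 2) ∷
    302 ▹ free (22 ▹ full 2) ∷ 344 ▹ 404 ▹ full 3 ∷ 012 ▹ free (14 ▹ full 2) ∷
    014 ▹ 323 ▹ full 3 ∷ 122 ▹ 123 ▹ full 3 ∷ 311 ▹ 303 ▹ full 3 ∷ 333 ▹ 212 ▹ full 3 ∷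
    121 ▹ 224 ▹ full 3 ∷ 030 ▹ 340 ▹ full 3 ∷ 241 ▹ 231 ▹ full 3 ∷ 041 ▹ 211 ▹ full 3 ∷
    122 ▹ 331 ▹ full 3 ∷ 233 ▹ 121 ▹ full 3 ∷ 421 ▹ 111 ▹ full 3 ∷ 441 ▹ 132 ▹ full 3 ∷
    302 ▹ 232 ▹ full 3 ∷ 431 ▹ 313 ▹ full 3 ∷ 124 ▹ 031 ▹ full 3 ∷ 032 ▹ 311 ▹ full 3 ∷
    434 ▹ 201 ▹ full 3 ∷ 334 ▹ 100 ▹ full 3 ∷ 141 ▹ 433 ▹ full 3 ∷ 144 ▹ 124 ▹ full 3 ∷
    022 ▹ 402 ▹ full 3 ∷ 402 ▹ 342 ▹ full 3 ∷ 033 ▹ 421 ▹ full 3 ∷ 200 ▹ 111 ▹ full 3 ∷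
    114 ▹ 414 ▹ full 3 ∷ 211 ▹ 331 ▹ full 3 ∷ 422 ▹ 400 ▹ full 3 ∷ 413 ▹ 434 ▹ full 3 ∷
    001 ▹ 140 ▹ full 3 ∷ 120 ▹ 312 ▹ full 3 ∷ 314 ▹ 410 ▹ full 3 ∷ 401 ▹ 233 ▹ full 3 ∷
    442 ▹ 420 ▹ full 3 ∷ 102 ▹ 240 ▹ full 3 ∷ 212 ▹ 301 ▹ full 3 ∷ 043 ▹ 312 ▹ full 3 ∷
    132 ▹ 142 ▹ full 3 ∷ 213 ▹ 233 ▹ full 3 ∷ 223 ▹ 044 ▹ full 3 ∷ 242 ▹ 413 ▹ full 3 ∷
    420 ▹ 343 ▹ full 3 ∷ 403 ▹ 311 ▹ full 3 ∷ 133 ▹ 201 ▹ full 3 ∷ 412 ▹ 204 ▹ full 3 ∷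
    001 ▹ 000 ▹ full 3 ∷ 133 ▹ 322 ▹ full 3 ∷ 401 ▹ 400 ▹ full 3 ∷ 413 ▹ 202 ▹ full 3 ∷
    242 ▹ 213 ▹ full 3 ∷ 230 ▹ 202 ▹ full 3 ∷ 040 ▹ 014 ▹ full 3 ∷ 403 ▹ 241 ▹ full 3 ∷
    142 ▹ 242 ▹ full 3 ∷ 303 ▹ 334 ▹ full 3 ∷ 011 ▹ 204 ▹ full 3 ∷ 414 ▹ 332 ▹ full 3 ∷
    411 ▹ 011 ▹ full 3 ∷ 004 ▹ 211 ▹ full 3 ∷ 310 ▹ 244 ▹ full 3 ∷ 234 ▹ 332 ▹ full 3 ∷
    134 ▹ 241 ▹ full 3 ∷ 322 ▹ 303 ▹ full 3 ∷ 231 ▹ free (03 ▹ full 2) ∷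
    333 ▹ free (13 ▹ full 2) ∷ 031 ▹ 114 ▹ full 3 ∷ 000 ▹ free (43 ▹ full 2) ∷
    111 ▹ 122 ▹ full 3 ∷ 231 ▹ 134 ▹ full 3 ∷ 144 ▹ 440 ▹ full 3 ∷ 103 ▹ 313 ▹ full 3 ∷
    334 ▹ 323 ▹ full 3 ∷ 044 ▹ 234 ▹ full 3 ∷ 441 ▹ 442 ▹ full 3 ∷ 332 ▹ 411 ▹ full 3 ∷
    134 ▹ 433 ▹ full 3 ∷ 324 ▹ 304 ▹ full 3 ∷ 032 ▹ 200 ▹ full 3 ∷ 022 ▹ 113 ▹ full 3 ∷
    211 ▹ 341 ▹ full 3 ∷ 411 ▹ 110 ▹ full 3 ∷ 223 ▹ 401 ▹ full 3 ∷ 412 ▹ 314 ▹ full 3 ∷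
    243 ▹ 420 ▹ full 3 ∷ 331 ▹ 424 ▹ full 3 ∷ 102 ▹ 131 ▹ full 3 ∷ 212 ▹ 143 ▹ full 3 ∷
    132 ▹ 134 ▹ full 3 ∷ 042 ▹ 120 ▹ full 3 ∷ 213 ▹ 304 ▹ full 3 ∷ 442 ▹ 110 ▹ full 3 ∷
    311 ▹ 033 ▹ full 3 ∷ 240 ▹ 443 ▹ full 3 ∷ 303 ▹ 133 ▹ full 3 ∷ 011 ▹ 302 ▹ full 3 ∷
    241 ▹ 112 ▹ full 3 ∷ 202 ▹ 344 ▹ full 3 ∷ 104 ▹ 340 ▹ full 3 ∷ 233 ▹ 220 ▹ full 3 ∷
    431 ▹ 101 ▹ full 3 ∷ 424 ▹ 121 ▹ full 3 ∷ 113 ▹ 232 ▹ full 3 ∷ 304 ▹ 231 ▹ full 3 ∷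
    422 ▹ 411 ▹ full 3 ∷ 044 ▹ 140 ▹ full 3 ∷ []

𝒮ᵇ : List (Subspace 5)
𝒮ᵇ = map subspace twoDimᵇ ++ map subspace threeDimᵇ

-- Family (c): 8 two-dimensional and 219 three-dimensional subspaces.

twoDimᶜ : List (Echelon 5 2)
twoDimᶜ =
    42 ▹ 34 ▹ 21 ▹ full 2 ∷ 33 ▹ 24 ▹ 13 ▹ full 2 ∷ 10 ▹ free (0 ▹ 4 ▹ full 1) ∷
    02 ▹ free (4 ▹ 0 ▹ full 1) ∷ 23 ▹ 02 ▹ 14 ▹ full 2 ∷ 34 ▹ 11 ▹ 22 ▹ full 2 ∷
    12 ▹ 44 ▹ 30 ▹ full 2 ∷ 10 ▹ 11 ▹ 01 ▹ full 2 ∷ []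

threeDimᶜ : List (Echelon 5 3)
threeDimᶜ =
    340 ▹ free (free (2 ▹ full 1)) ∷ 043 ▹ 404 ▹ full 3 ∷ 214 ▹ 341 ▹ full 3 ∷
    120 ▹ free (41 ▹ full 2) ∷ 002 ▹ free (41 ▹ full 2) ∷ 244 ▹ 133 ▹ full 3 ∷
    213 ▹ 403 ▹ full 3 ∷ 430 ▹ 342 ▹ full 3 ∷ 442 ▹ 143 ▹ full 3 ∷ 440 ▹ 144 ▹ full 3 ∷
    013 ▹ 112 ▹ full 3 ∷ 034 ▹ 104 ▹ full 3 ∷ free (14 ▹ free (2 ▹ full 1)) ∷ 430 ▹ 120 ▹ full 3 ∷
    443 ▹ 141 ▹ full 3 ∷ 420 ▹ free (free (free (0 ▹ []))) ∷ 243 ▹ free (free (free (0 ▹ []))) ∷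
    202 ▹ 343 ▹ full 3 ∷ 311 ▹ 402 ▹ full 3 ∷ 000 ▹ 402 ▹ full 3 ∷ 323 ▹ 121 ▹ full 3 ∷
    000 ▹ 343 ▹ full 3 ∷ 404 ▹ free (40 ▹ full 2) ∷ 224 ▹ free (40 ▹ full 2) ∷
    322 ▹ 124 ▹ full 3 ∷ 003 ▹ 313 ▹ full 3 ∷ 331 ▹ 424 ▹ full 3 ∷ 311 ▹ free (00 ▹ full 2) ∷
    311 ▹ free (34 ▹ full 2) ∷ 301 ▹ 430 ▹ full 3 ∷ 204 ▹ 134 ▹ full 3 ∷ 041 ▹ 323 ▹ full 3 ∷
    101 ▹ 430 ▹ full 3 ∷ 232 ▹ 132 ▹ full 3 ∷ 020 ▹ free (24 ▹ full 2) ∷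
    131 ▹ free (11 ▹ full 2) ∷ 304 ▹ 323 ▹ full 3 ∷ 020 ▹ 132 ▹ full 3 ∷ 021 ▹ 134 ▹ full 3 ∷
    233 ▹ free (free (0 ▹ full 1)) ∷ 412 ▹ free (free (4 ▹ full 1)) ∷ 133 ▹ 434 ▹ full 3 ∷
    324 ▹ 101 ▹ full 3 ∷ 324 ▹ 324 ▹ full 3 ∷ 123 ▹ 004 ▹ full 3 ∷ 301 ▹ 102 ▹ full 3 ∷
    030 ▹ 321 ▹ full 3 ∷ 313 ▹ 432 ▹ full 3 ∷ 231 ▹ 220 ▹ full 3 ∷ 413 ▹ 233 ▹ full 3 ∷
    342 ▹ 012 ▹ full 3 ∷ free (10 ▹ 02 ▹ full 2) ∷ free (42 ▹ 31 ▹ full 2) ∷ 023 ▹ 312 ▹ full 3 ∷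
    001 ▹ 043 ▹ full 3 ∷ 310 ▹ 420 ▹ full 3 ∷ 033 ▹ 213 ▹ full 3 ∷ 120 ▹ 210 ▹ full 3 ∷
    402 ▹ 330 ▹ full 3 ∷ 234 ▹ 444 ▹ full 3 ∷ 424 ▹ 040 ▹ full 3 ∷ 421 ▹ 423 ▹ full 3 ∷
    131 ▹ 314 ▹ full 3 ∷ 130 ▹ free (03 ▹ full 2) ∷ 032 ▹ free (32 ▹ full 2) ∷
    203 ▹ free (13 ▹ full 2) ∷ 022 ▹ 204 ▹ full 3 ∷ 413 ▹ free (21 ▹ full 2) ∷
    303 ▹ free (20 ▹ full 2) ∷ 422 ▹ 033 ▹ full 3 ∷ 300 ▹ 301 ▹ full 3 ∷ 132 ▹ 410 ▹ full 3 ∷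
    324 ▹ free (12 ▹ full 2) ∷ 223 ▹ 214 ▹ full 3 ∷ 121 ▹ 044 ▹ full 3 ∷
    342 ▹ free (43 ▹ full 2) ∷ 334 ▹ free (43 ▹ full 2) ∷ 422 ▹ 001 ▹ full 3 ∷
    413 ▹ free (10 ▹ full 2) ∷ 041 ▹ 223 ▹ full 3 ∷ 400 ▹ 131 ▹ full 3 ∷
    223 ▹ free (23 ▹ full 2) ∷ 444 ▹ 103 ▹ full 3 ∷ 403 ▹ 100 ▹ full 3 ∷ 423 ▹ 130 ▹ full 3 ∷
    414 ▹ 021 ▹ full 3 ∷ 021 ▹ 240 ▹ full 3 ∷ 201 ▹ free (03 ▹ full 2) ∷
    444 ▹ free (32 ▹ full 2) ∷ 142 ▹ 322 ▹ full 3 ∷ 011 ▹ 221 ▹ full 3 ∷ 424 ▹ 431 ▹ full 3 ∷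
    131 ▹ 211 ▹ full 3 ∷ 402 ▹ 003 ▹ full 3 ∷ 432 ▹ free (31 ▹ full 2) ∷
    213 ▹ free (02 ▹ full 2) ∷ 040 ▹ 042 ▹ full 3 ∷ 222 ▹ 210 ▹ full 3 ∷ 124 ▹ 043 ▹ full 3 ∷
    344 ▹ 030 ▹ full 3 ∷ 434 ▹ 202 ▹ full 3 ∷ 343 ▹ 022 ▹ full 3 ∷ 201 ▹ 310 ▹ full 3 ∷
    420 ▹ 244 ▹ full 3 ∷ 003 ▹ 333 ▹ full 3 ∷ 024 ▹ 422 ▹ full 3 ∷ 410 ▹ 344 ▹ full 3 ∷
    233 ▹ 401 ▹ full 3 ∷ 303 ▹ 441 ▹ full 3 ∷ 141 ▹ 122 ▹ full 3 ∷ 110 ▹ 123 ▹ full 3 ∷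
    031 ▹ 041 ▹ full 3 ∷ 144 ▹ 212 ▹ full 3 ∷ 332 ▹ 233 ▹ full 3 ∷ 332 ▹ 331 ▹ full 3 ∷
    203 ▹ 012 ▹ full 3 ∷ 203 ▹ 440 ▹ full 3 ∷ 134 ▹ 443 ▹ full 3 ∷ 144 ▹ 331 ▹ full 3 ∷
    433 ▹ 443 ▹ full 3 ∷ 433 ▹ 334 ▹ full 3 ∷ 231 ▹ 334 ▹ full 3 ∷ 014 ▹ 440 ▹ full 3 ∷
    230 ▹ 023 ▹ full 3 ∷ 311 ▹ 243 ▹ full 3 ∷ 314 ▹ 124 ▹ full 3 ∷ 331 ▹ 121 ▹ full 3 ∷
    free (20 ▹ free (3 ▹ full 1)) ∷ free (00 ▹ free (1 ▹ full 1)) ∷ 210 ▹ 142 ▹ full 3 ∷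
    314 ▹ 224 ▹ full 3 ∷ 230 ▹ 140 ▹ full 3 ∷ 321 ▹ free (free (1 ▹ full 1)) ∷
    210 ▹ 000 ▹ full 3 ∷ 231 ▹ free (42 ▹ full 2) ∷ 441 ▹ free (42 ▹ full 2) ∷
    322 ▹ free (free (3 ▹ full 1)) ∷ 014 ▹ 032 ▹ full 3 ∷ 102 ▹ 200 ▹ full 3 ∷
    free (22 ▹ 20 ▹ full 2) ∷ free (13 ▹ 12 ▹ full 2) ∷ 243 ▹ 213 ▹ full 3 ∷ 221 ▹ 444 ▹ full 3 ∷
    100 ▹ 040 ▹ full 3 ∷ 344 ▹ 010 ▹ full 3 ∷ 410 ▹ 330 ▹ full 3 ∷ 141 ▹ 033 ▹ full 3 ∷
    241 ▹ 204 ▹ full 3 ∷ 412 ▹ 230 ▹ full 3 ∷ 211 ▹ 301 ▹ full 3 ∷ 001 ▹ 410 ▹ full 3 ∷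
    011 ▹ free (23 ▹ full 2) ∷ 144 ▹ free (10 ▹ full 2) ∷ 103 ▹ 310 ▹ full 3 ∷
    212 ▹ 103 ▹ full 3 ∷ 400 ▹ 422 ▹ full 3 ∷ 113 ▹ 240 ▹ full 3 ∷ 242 ▹ 100 ▹ full 3 ∷
    124 ▹ 404 ▹ full 3 ∷ 303 ▹ 341 ▹ full 3 ∷ 043 ▹ 021 ▹ full 3 ∷ 111 ▹ 123 ▹ full 3 ∷
    142 ▹ 122 ▹ full 3 ∷ 430 ▹ free (01 ▹ full 2) ∷ 222 ▹ free (30 ▹ full 2) ∷
    013 ▹ 411 ▹ full 3 ∷ 432 ▹ 201 ▹ full 3 ∷ 201 ▹ 300 ▹ full 3 ∷ 130 ▹ 114 ▹ full 3 ∷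
    343 ▹ 031 ▹ full 3 ∷ 233 ▹ 342 ▹ full 3 ∷ 024 ▹ 403 ▹ full 3 ∷ 112 ▹ 110 ▹ full 3 ∷
    240 ▹ 441 ▹ full 3 ∷ 440 ▹ 333 ▹ full 3 ∷ free (34 ▹ 04 ▹ full 2) ∷ free (14 ▹ 33 ▹ full 2) ∷
    320 ▹ 142 ▹ full 3 ∷ 243 ▹ 340 ▹ full 3 ∷ 340 ▹ 140 ▹ full 3 ∷ 330 ▹ 222 ▹ full 3 ∷
    010 ▹ 400 ▹ full 3 ∷ 312 ▹ 001 ▹ full 3 ∷ 431 ▹ 223 ▹ full 3 ∷ 241 ▹ 002 ▹ full 3 ∷
    224 ▹ 242 ▹ full 3 ∷ 102 ▹ 024 ▹ full 3 ∷ 333 ▹ 004 ▹ full 3 ∷ 412 ▹ 220 ▹ full 3 ∷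
    242 ▹ 232 ▹ full 3 ∷ 342 ▹ 201 ▹ full 3 ∷ 122 ▹ 013 ▹ full 3 ∷ 130 ▹ 434 ▹ full 3 ∷
    211 ▹ 031 ▹ full 3 ∷ 044 ▹ 414 ▹ full 3 ∷ 221 ▹ 302 ▹ full 3 ∷ 321 ▹ 324 ▹ full 3 ∷
    030 ▹ 311 ▹ full 3 ∷ 302 ▹ 421 ▹ full 3 ∷ 423 ▹ 003 ▹ full 3 ∷ 040 ▹ 221 ▹ full 3 ∷
    403 ▹ 322 ▹ full 3 ∷ 222 ▹ 431 ▹ full 3 ∷ 031 ▹ 030 ▹ full 3 ∷ 134 ▹ 202 ▹ full 3 ∷
    -- The four subspaces from `004 ▹ 020 ▹ full 3` to `140 ▹ 303 ▹ full 3` are listed twice, that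
    -- is, with multiplicity two.
    110 ▹ 344 ▹ full 3 ∷ 420 ▹ 401 ▹ full 3 ∷ 004 ▹ 020 ▹ full 3 ∷ 104 ▹ 241 ▹ full 3 ∷
    404 ▹ 413 ▹ full 3 ∷ 140 ▹ 303 ▹ full 3 ∷ 004 ▹ 020 ▹ full 3 ∷ 104 ▹ 241 ▹ full 3 ∷
    404 ▹ 413 ▹ full 3 ∷ 140 ▹ 303 ▹ full 3 ∷ 122 ▹ 421 ▹ full 3 ∷ 321 ▹ 311 ▹ full 3 ∷
    333 ▹ 414 ▹ full 3 ∷ 044 ▹ 302 ▹ full 3 ∷ []

𝒮ᶜ : List (Subspace 5)
𝒮ᶜ = map subspace twoDimᶜ ++ map subspace threeDimᶜ

mainTheorem8 : (Σ[ 𝒮 ∈ List (Subspace 5) ]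
    map dim 𝒮 ↭ replicate 20 2 ++ replicate 157 3
    × (∀ (H : Subspace 5) → IsHyperplane H → #ContainedIn 𝒮 H ≡ 2)
    × IsMultispread 80 7 3 5 𝒮)
    × (Σ[ 𝒮 ∈ List (Subspace 5) ]
    map dim 𝒮 ↭ replicate 14 2 ++ replicate 188 3
    × (∀ (H : Subspace 5) → IsHyperplane H → #ContainedIn 𝒮 H ≡ 2)
    × IsMultispread 56 8 3 5 𝒮)
    × (Σ[ 𝒮 ∈ List (Subspace 5) ]
    map dim 𝒮 ↭ replicate 8 2 ++ replicate 219 3
    × (∀ (H : Subspace 5) → IsHyperplane H → #ContainedIn 𝒮 H ≡ 2)
    × IsMultispread 32 9 3 5 𝒮)
mainTheorem8 =
    multispread 20 157 80 7 𝒮ᵃ refl refl refl refl refl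
  , multispread 14 188 56 8 𝒮ᵇ refl refl refl refl refl
  , multispread 8 219 32 9 𝒮ᶜ refl refl refl refl refl
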